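{- Let $p$ be a prime and let $n$ be a non-negative integer with base-$p$ expansion $$n=a_0+a_1p+\cdots+a_kp^k+a_{k+1}p^{k+1}+\cdots+a_lp^l,$$ where $0\le a_i\le p-1$ for all $i$, and let $k$ be a positive integer with $1\le k\le l$. Put $$a_{(k)}=a_k+a_{k+1}p+\cdots+a_lp^{l-k},\qquad b_{(k)}=a_0+a_1p+\cdots+a_{k-1}p^{k-1},$$ so that $n=a_{(k)}p^k+b_{(k)}$ with $0\le b_{(k)}\le p^k-1$. Then $$\binom{a_{(k)}p^k+b_{(k)}}{p^k}-\left\lfloor\frac{a_{(k)}p^k+b_{(k)}}{p^k}\right\rfloor\equiv 0\pmod p.$$
   Context: $\lfloor\cdot\rfloor$ denotes the floor function, and $\binom{m}{j}$ is the usual binomial coefficient, equal to $0$ when $m<j$. -}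

module Defs where

open import Data.Nat.Base using (ℕ)
open import Data.Integer.Base using (ℤ; +_; _-_)
open import Data.Integer.Divisibility.Signed using (_∣_)

infix 4 _≈_[mod_]

_≈_[mod_] : ℤ → ℤ → ℕ → Set
x ≈ y [mod m ] = (+ m) ∣ (x - y)

{-# OPTIONS --safe #-}

-- Write q = p ^ k. Since i * (q C i) = q * (q ∸ 1 C (i ∸ 1)), all interior entries of row q
-- of Pascal's triangle are divisible by p, so modulo p the row of m + q agrees with the row of m in columns below q and exceeds it
-- by 1 in column q. Hence each of the a₍ₖ₎ blocks of size q contributes 1 to N C q.
module Submission where

open import Data.Nat using (ℕ; zero; suc; _+_; _*_; _∸_; _^_; _≤_; _<_; z≤n; s≤s; z<s; s<s; NonZero; ≢-nonZero; ≢-nonZero⁻¹)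
open import Data.Nat.Properties using
  ( +-0-monoid; m^n≢0; m*n≢0; +-*-semiring; +-identityʳ; +-assoc; +-suc; +-comm; *-assoc; *-comm
  ; *-identityʳ; *-zeroʳ; *-suc; *-monoʳ-≤; +-monoˡ-≤; ^-distribˡ-+-*; <⇒≤; ≤-trans; <⇒≱
  ; n<1+n; m+[n∸m]≡n; ∸-monoˡ-≤; suc-pred; module ≤-Reasoning )
open import Data.Nat.Primality using (Prime; prime⇒nonZero; euclidsLemma)
open import Data.Nat.Combinatorics using (_C_; nC1≡n; nCn≡1; nCk≡nC[n∸k]; k>n⇒nCk≡0; nCk+nC[k+1]≡[n+1]C[k+1])
open import Data.Nat.GCD using (gcd; gcd[m,n]∣m; gcd[m,n]∣n; gcd[m,n]≢0; n/gcd[m,n]≢0)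
open import Data.Nat.Coprimality using (Coprime; coprime-/gcd)
open import Data.Nat.Tactic.RingSolver using (solve-∀)
import Data.Nat.Divisibility as ℕ
import Data.Nat.DivMod as ℕ
open import Data.Fin using (toℕ)
open import Data.Integer using (+_; _-_; 0ℤ)
import Data.Integer as ℤ
import Data.Integer.Properties as ℤ
open import Data.Integer.Divisibility.Signed using (_∣_; ∣ᵤ⇒∣; ∣m∣n⇒∣m+n)
import Data.Integer.Tactic.RingSolver as ℤ-Solver
open import Data.Rational using (_/_; floor)
open import Data.Rational.Base using (mkℚ+)
open import Data.Product using (_×_; _,_)
open import Data.Sum using (_⊎_; inj₁; inj₂)
import Data.Sum as Sum
open import Function using (_∘_; id)
open import Relation.Nullary using (contradiction)
open import Relation.Binary.PropositionalEquality using (_≡_; refl; sym; trans; cong; cong₂; subst; subst₂; module ≡-Reasoning)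
open import Algebra.Properties.Monoid.Sum +-0-monoid using (sum-syntax; sum⁺-syntax; sum-cong-≗)
open import Algebra.Properties.Semiring.Sum +-*-semiring using (*-distribˡ-sum; *-distribʳ-sum)
open import Defs

nC0≡1 : ∀ n → n C 0 ≡ 1
nC0≡1 n = trans (nCk≡nC[n∸k] {k = 0} {n = n} z≤n) (nCn≡1 n)

-- The absorption identity, by induction on `n`: after Pascal's rule, setting one copy of `c` aside
-- leaves exactly two instances of the induction hypothesis, and Pascal's rule one row lower merges
-- their right-hand sides.
[k+1]*[n+1]C[k+1]≡[n+1]*nCk : ∀ n k → suc k * (suc n C suc k) ≡ suc n * (n C k)
[k+1]*[n+1]C[k+1]≡[n+1]*nCk zero zero = refl
[k+1]*[n+1]C[k+1]≡[n+1]*nCk zero (suc k) = trans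
  (cong (suc (suc k) *_) (k>n⇒nCk≡0 {1} {suc (suc k)} (s<s z<s)))
  (trans (*-zeroʳ k) (sym (cong (1 *_) (k>n⇒nCk≡0 {0} {suc k} z<s))))
[k+1]*[n+1]C[k+1]≡[n+1]*nCk (suc n) zero = begin
  1 * (suc (suc n) C 1)        ≡⟨ cong (1 *_) (nC1≡n (suc (suc n))) ⟩
  1 * suc (suc n)              ≡⟨ *-comm 1 (suc (suc n)) ⟩
  suc (suc n) * 1              ≡⟨ cong (suc (suc n) *_) (nC0≡1 (suc n)) ⟨
  suc (suc n) * (suc n C 0)    ∎
  where open ≡-Reasoning
[k+1]*[n+1]C[k+1]≡[n+1]*nCk (suc n) (suc k) = begin
  suc (suc k) * (suc (suc n) C suc (suc k))
    ≡⟨ cong (suc (suc k) *_) (nCk+nC[k+1]≡[n+1]C[k+1] (suc n) (suc k)) ⟨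
  suc (suc k) * (c + c′)
    ≡⟨ expand k c c′ ⟩
  c + (suc k * c + suc (suc k) * c′)
    ≡⟨ cong (_+_ c) (cong₂ _+_ ([k+1]*[n+1]C[k+1]≡[n+1]*nCk n k) ([k+1]*[n+1]C[k+1]≡[n+1]*nCk n (suc k))) ⟩
  c + (suc n * (n C k) + suc n * (n C suc k))
    ≡⟨ collect n c (n C k) (n C suc k) ⟩
  c + suc n * (n C k + n C suc k)
    ≡⟨ cong (λ x → c + suc n * x) (nCk+nC[k+1]≡[n+1]C[k+1] n k) ⟩
  suc (suc n) * c ∎
  where
  open ≡-Reasoning
  c = suc n C suc k
  c′ = suc n C suc (suc k)
  expand : ∀ k x y → suc (suc k) * (x + y) ≡ x + (suc k * x + suc (suc k) * y)
  expand = solve-∀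
  collect : ∀ n c x y → c + (suc n * x + suc n * y) ≡ c + suc n * (x + y)
  collect = solve-∀

-- Euclid's lemma removes one factor `p` at a time from `m`; if it ever points to `n` instead, the
-- second alternative holds.
p^k∣m*n⇒p^k∣m⊎p∣n : ∀ {p} → Prime p → ∀ k m n → p ^ k ℕ.∣ m * n → p ^ k ℕ.∣ m ⊎ p ℕ.∣ n
p^k∣m*n⇒p^k∣m⊎p∣n pr zero m n _ = inj₁ (ℕ.1∣ m)
p^k∣m*n⇒p^k∣m⊎p∣n {p} pr (suc k) m n d
  with euclidsLemma m n pr (ℕ.∣-trans (ℕ.m∣m*n (p ^ k)) d)
... | inj₂ p∣n = inj₂ p∣n
... | inj₁ (ℕ.divides-refl m′) =
  Sum.map₁ (λ h → subst (p * p ^ k ℕ.∣_) (*-comm p m′) (ℕ.*-monoʳ-∣ p h))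
    (p^k∣m*n⇒p^k∣m⊎p∣n pr k m′ n (ℕ.*-cancelˡ-∣ p (subst (p * p ^ k ℕ.∣_) (rotate m′ p n) d)))
  where
  instance _ = prime⇒nonZero pr
  rotate : ∀ x y z → x * y * z ≡ y * (x * z)
  rotate = solve-∀

-- By absorption `p ^ k` divides `suc i * (p ^ k C suc i)`, but it is too large to divide `suc i`,
-- so `p` must divide the other factor.
p∣p^kCi : ∀ {p} → Prime p → ∀ k i → suc i < p ^ k → p ℕ.∣ (p ^ k C suc i)
p∣p^kCi {p} pr k i i<q = Sum.[ (λ q∣i → contradiction (ℕ.∣⇒≤ q∣i) (<⇒≱ i<q)) , id ]
  (p^k∣m*n⇒p^k∣m⊎p∣n pr k (suc i) (p ^ k C suc i) (absorb (p ^ k)))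
  where
  instance _ = m^n≢0 p k {{prime⇒nonZero pr}}
  -- `p ^ k` is generalised to a nonzero `q` so that it can be split as `suc r`, the shape in which
  -- absorption applies.
  absorb : ∀ q .{{_ : NonZero q}} → q ℕ.∣ suc i * (q C suc i)
  absorb (suc r) = subst (suc r ℕ.∣_) (sym ([k+1]*[n+1]C[k+1]≡[n+1]*nCk r i)) (ℕ.m∣m*n (r C i))

≈-reflexive : ∀ {m x y} → x ≡ y → x ≈ y [mod m ]
≈-reflexive {m} {x} refl = subst (+ m ∣_) (sym (ℤ.+-inverseʳ x)) (∣ᵤ⇒∣ (m ℕ.∣0))

≈-trans : ∀ {m x y z} → x ≈ y [mod m ] → y ≈ z [mod m ] → x ≈ z [mod m ]
≈-trans {m} {x} {y} {z} x≈y y≈z = subst (+ m ∣_) (telescope x y z) (∣m∣n⇒∣m+n x≈y y≈z)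
  where
  telescope : ∀ x y z → (x - y) ℤ.+ (y - z) ≡ x - z
  telescope = ℤ-Solver.solve-∀

+-cong-≈ : ∀ {m x y u v} → x ≈ y [mod m ] → u ≈ v [mod m ] → (x ℤ.+ u) ≈ (y ℤ.+ v) [mod m ]
+-cong-≈ {m} {x} {y} {u} {v} x≈y u≈v = subst (+ m ∣_) (interchange x y u v) (∣m∣n⇒∣m+n x≈y u≈v)
  where
  interchange : ∀ x y u v → (x - y) ℤ.+ (u - v) ≡ (x ℤ.+ u) - (y ℤ.+ v)
  interchange = ℤ-Solver.solve-∀

∣⇒≈0 : ∀ {m n} → m ℕ.∣ n → + n ≈ 0ℤ [mod m ]
∣⇒≈0 {m} {n} m∣n = subst (+ m ∣_) (sym (ℤ.+-identityʳ (+ n))) (∣ᵤ⇒∣ m∣n)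

module _ {p q : ℕ} (p∣qCi : ∀ i → suc i < q → p ℕ.∣ (q C suc i)) where

  -- Rows `q` and `0` agree modulo `p` in these columns, and Pascal's rule carries the agreement
  -- from row to row.
  [m+q]Cj≈mCj : ∀ m j → j < q → + ((m + q) C j) ≈ + (m C j) [mod p ]
  [m+q]Cj≈mCj m zero _ = ≈-reflexive (cong +_ (trans (nC0≡1 (m + q)) (sym (nC0≡1 m))))
  [m+q]Cj≈mCj zero (suc j) j<q =
    subst (λ x → + (q C suc j) ≈ + x [mod p ]) (sym (k>n⇒nCk≡0 {0} {suc j} z<s)) (∣⇒≈0 (p∣qCi j j<q))
  [m+q]Cj≈mCj (suc m) (suc j) j<q =
    subst₂ (λ x y → + x ≈ + y [mod p ])
      (nCk+nC[k+1]≡[n+1]C[k+1] (m + q) j) (nCk+nC[k+1]≡[n+1]C[k+1] m j)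
      (+-cong-≈ {x = + ((m + q) C j)} {y = + (m C j)} {u = + ((m + q) C suc j)} {v = + (m C suc j)}
        -- Here `j<q` states `suc j < q`; weakened to `suc j ≤ q`, it is the bound for column `j`.
        ([m+q]Cj≈mCj m j (<⇒≤ j<q)) ([m+q]Cj≈mCj m (suc j) j<q))

-- The extra 1 is `q C q` in the base row. Pascal's rule preserves it, since the neighbouring column
-- `r`, one below `q`, contributes equally to both sides.
[m+q]Cq≈1+mCq : ∀ {p} q .{{_ : NonZero q}} → (∀ i → suc i < q → p ℕ.∣ (q C suc i)) →
  ∀ m → + ((m + q) C q) ≈ + suc (m C q) [mod p ]
[m+q]Cq≈1+mCq q@(suc r) p∣qCi zero =
  ≈-reflexive (cong +_ (trans (nCn≡1 q) (cong suc (sym (k>n⇒nCk≡0 {0} {q} z<s)))))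
[m+q]Cq≈1+mCq {p} q@(suc r) p∣qCi (suc m) =
  subst₂ (λ x y → + x ≈ + y [mod p ])
    (nCk+nC[k+1]≡[n+1]C[k+1] (m + q) r)
    (trans (+-suc (m C r) (m C q)) (cong suc (nCk+nC[k+1]≡[n+1]C[k+1] m r)))
    (+-cong-≈ {x = + ((m + q) C r)} {y = + (m C r)} {u = + ((m + q) C q)} {v = + suc (m C q)}
      ([m+q]Cj≈mCj p∣qCi m r (n<1+n r)) ([m+q]Cq≈1+mCq q p∣qCi m))

[a*q+b]Cq≈a : ∀ {p} q .{{_ : NonZero q}} → (∀ i → suc i < q → p ℕ.∣ (q C suc i)) →
  ∀ a {b} → b < q → + ((a * q + b) C q) ≈ + a [mod p ]
[a*q+b]Cq≈a q p∣qCi zero b<q = ≈-reflexive (cong +_ (k>n⇒nCk≡0 b<q))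
[a*q+b]Cq≈a {p} q p∣qCi (suc a) {b} b<q =
  ≈-trans {x = + ((suc a * q + b) C q)} {y = + suc ((a * q + b) C q)} {z = + suc a}
    (subst (λ x → + (x C q) ≈ + suc ((a * q + b) C q) [mod p ]) (rotate a q b) ([m+q]Cq≈1+mCq q p∣qCi (a * q + b)))
    (+-cong-≈ {x = + 1} {y = + 1} {u = + ((a * q + b) C q)} {v = + a} (≈-reflexive {x = + 1} refl) ([a*q+b]Cq≈a q p∣qCi a b<q))
  where
  rotate : ∀ a q b → a * q + b + q ≡ q + a * q + b
  rotate = solve-∀

floor-mkℚ+ : ∀ n d .{{_ : NonZero d}} .(c : Coprime n d) → floor (mkℚ+ n d c) ≡ + (n ℕ./ d)
floor-mkℚ+ n (suc d) c = ℤ.*-identityˡ (+ (n ℕ./ suc d))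

-- The rational `+ m / d` is stored in lowest terms, and cancelling the gcd from both parts leaves
-- the integer quotient unchanged.
floor-/ : ∀ m d .{{_ : NonZero d}} → floor (+ m / d) ≡ + (m ℕ./ d)
floor-/ m d = trans (floor-mkℚ+ (m ℕ./ g) (d ℕ./ g) (coprime-/gcd m d)) (cong +_ (begin
  (m ℕ./ g) ℕ./ (d ℕ./ g)              ≡⟨ ℕ.m*n/o*n≡m/o (m ℕ./ g) g (d ℕ./ g) ⟨
  (m ℕ./ g * g) ℕ./ (d ℕ./ g * g)      ≡⟨ ℕ./-congˡ {o = d ℕ./ g * g} (ℕ.m/n*n≡m (gcd[m,n]∣m m d)) ⟩
  m ℕ./ (d ℕ./ g * g)                  ≡⟨ ℕ./-congʳ (ℕ.m/n*n≡m (gcd[m,n]∣n m d)) ⟩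
  m ℕ./ d                              ∎))
  where
  open ≡-Reasoning
  g = gcd m d
  instance
    g≢0 : NonZero g
    g≢0 = ≢-nonZero (gcd[m,n]≢0 m d (inj₂ (≢-nonZero⁻¹ d)))
    d/g≢0 : NonZero (d ℕ./ g)
    d/g≢0 = ≢-nonZero (n/gcd[m,n]≢0 m d {{gcd≢0 = g≢0}})
    d/g*g≢0 : NonZero (d ℕ./ g * g)
    d/g*g≢0 = m*n≢0 (d ℕ./ g) g

∑-split : ∀ (f : ℕ → ℕ) k d →
  (∑[ i < k + d ] f (toℕ i)) ≡ (∑[ i < k ] f (toℕ i)) + (∑[ i < d ] f (k + toℕ i))
∑-split f zero d = refl
∑-split f (suc k) d = trans (cong (_+_ (f 0)) (∑-split (f ∘ suc) k d)) (sym (+-assoc (f 0) _ _))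

∑-digits-bound : ∀ p .{{_ : NonZero p}} k (a : ℕ → ℕ) → (∀ i → i < k → a i < p) →
  (∑[ i < k ] (a (toℕ i) * p ^ toℕ i)) < p ^ k
∑-digits-bound p zero a a<p = s≤s z≤n
∑-digits-bound p (suc k) a a<p = begin-strict
  a 0 * 1 + (∑[ i < k ] (a (suc (toℕ i)) * (p * p ^ toℕ i)))
    ≡⟨ cong (_+_ (a 0 * 1)) (sum-cong-≗ {k} (λ i → swap (a (suc (toℕ i))) p (p ^ toℕ i))) ⟩
  a 0 * 1 + (∑[ i < k ] (p * (a (suc (toℕ i)) * p ^ toℕ i)))
    ≡⟨ cong₂ _+_ (*-identityʳ (a 0)) (sym (*-distribˡ-sum {k} p (λ i → a (suc (toℕ i)) * p ^ toℕ i))) ⟩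
  a 0 + p * s
    -- `a 0 < p` unfolds to `suc (a 0) ≤ p`, which makes this step strict; likewise `s < p ^ k` is
    -- used below as `suc s ≤ p ^ k`.
    <⟨ +-monoˡ-≤ (p * s) (a<p 0 z<s) ⟩
  p + p * s
    ≡⟨ *-suc p s ⟨
  p * suc s
    ≤⟨ *-monoʳ-≤ p (∑-digits-bound p k (a ∘ suc) (λ i i<k → a<p (suc i) (s<s i<k))) ⟩
  p * p ^ k ∎
  where
  open ≤-Reasoning
  s = ∑[ i < k ] (a (suc (toℕ i)) * p ^ toℕ i)
  swap : ∀ x y z → x * (y * z) ≡ y * (x * z)
  swap = solve-∀

∑-digits-split : ∀ p (a : ℕ → ℕ) {k l} → k ≤ l →
  (∑[ i ≤ l ] (a (toℕ i) * p ^ toℕ i)) ≡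
  (∑[ i ≤ l ∸ k ] (a (k + toℕ i) * p ^ toℕ i)) * p ^ k + (∑[ i < k ] (a (toℕ i) * p ^ toℕ i))
∑-digits-split p a {k} {l} k≤l = begin
  (∑[ i ≤ l ] f (toℕ i))
    ≡⟨ cong (λ m → ∑[ i < m ] f (toℕ i)) 1+l≡k+d ⟩
  (∑[ i < k + d ] f (toℕ i))
    ≡⟨ ∑-split f k d ⟩
  low + (∑[ i < d ] (a (k + toℕ i) * p ^ (k + toℕ i)))
    ≡⟨ cong (_+_ low) (sum-cong-≗ {d} (λ i → shift (toℕ i))) ⟩
  low + (∑[ i < d ] (a (k + toℕ i) * p ^ toℕ i * p ^ k))
    ≡⟨ cong (_+_ low) (*-distribʳ-sum {d} (p ^ k) (λ i → a (k + toℕ i) * p ^ toℕ i)) ⟨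
  low + high * p ^ k
    ≡⟨ +-comm low (high * p ^ k) ⟩
  high * p ^ k + low ∎
  where
  open ≡-Reasoning
  f : ℕ → ℕ
  f i = a i * p ^ i
  d = suc (l ∸ k)
  low = ∑[ i < k ] f (toℕ i)
  high = ∑[ i < d ] (a (k + toℕ i) * p ^ toℕ i)
  -- The sum up to and including `l` has `suc l` terms: `k` low ones and `suc (l ∸ k)` high ones.
  1+l≡k+d : suc l ≡ k + d
  1+l≡k+d = sym (trans (+-suc k (l ∸ k)) (cong suc (m+[n∸m]≡n k≤l)))
  shift : ∀ i → a (k + i) * p ^ (k + i) ≡ a (k + i) * p ^ i * p ^ k
  shift i = trans (cong (a (k + i) *_) (trans (^-distribˡ-+-* p k i) (*-comm (p ^ k) (p ^ i))))
                  (sym (*-assoc (a (k + i)) (p ^ i) (p ^ k)))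

theorem3p1 : ∀ (p : ℕ) (p-prime : Prime p) (n l : ℕ) (a : ℕ → ℕ) →
    (∀ i → i ≤ l → a i ≤ p ∸ 1) →
    n ≡ ∑[ i ≤ l ] (a (toℕ i) * p ^ toℕ i) →
    ∀ (k : ℕ) → 1 ≤ k → k ≤ l →
    let a₍ₖ₎ = ∑[ i ≤ l ∸ k ] (a (k + toℕ i) * p ^ toℕ i)
        b₍ₖ₎ = ∑[ i < k ] (a (toℕ i) * p ^ toℕ i)
        N = a₍ₖ₎ * p ^ k + b₍ₖ₎
        instance p^k≢0 = m^n≢0 p k {{prime⇒nonZero p-prime}}
    in n ≡ N
       × b₍ₖ₎ ≤ p ^ k ∸ 1
       × + (N C (p ^ k)) - ⌊ + N / (p ^ k) ⌋ ≈ 0ℤ [mod p ]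
theorem3p1 p p-prime n l a a≤p-1 n≡∑ k _ k≤l =
  trans n≡∑ (∑-digits-split p a k≤l) , ∸-monoˡ-≤ 1 b<q ,
  subst (λ x → + (N C q) - x ≈ 0ℤ [mod p ]) (sym ⌊N/q⌋≡h)
    -- Congruence to `0ℤ` means divisibility of the difference minus zero; without the zero it is
    -- the congruence of `N C q` and `h`.
    (subst (+ p ∣_) (sym (ℤ.+-identityʳ _)) ([a*q+b]Cq≈a q (p∣p^kCi p-prime k) h b<q))
  where
  open ≡-Reasoning
  instance
    p≢0 = prime⇒nonZero p-prime
    q≢0 = m^n≢0 p k
  q = p ^ k
  h = ∑[ i ≤ l ∸ k ] (a (k + toℕ i) * p ^ toℕ i)
  b = ∑[ i < k ] (a (toℕ i) * p ^ toℕ i)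
  N = h * q + b
  digit< : ∀ i → i ≤ l → a i < p
  -- As `p` is nonzero, the truncated `p ∸ 1` has successor `p`.
  digit< i i≤l = subst (suc (a i) ≤_) (suc-pred p) (s≤s (a≤p-1 i i≤l))
  b<q : b < q
  b<q = ∑-digits-bound p k a (λ i i<k → digit< i (≤-trans (<⇒≤ i<k) k≤l))
  ⌊N/q⌋≡h : floor (+ N / q) ≡ + h
  ⌊N/q⌋≡h = trans (floor-/ N q) (cong +_ (begin
    -- The quotient splits over the sum because `q` divides the first summand; the remainder `b`
    -- then contributes 0.
    (h * q + b) ℕ./ q            ≡⟨ ℕ.+-distrib-/-∣ˡ b (ℕ.n∣m*n h) ⟩
    h * q ℕ./ q + b ℕ./ q        ≡⟨ cong₂ _+_ (ℕ.m*n/n≡m h q) (ℕ.m<n⇒m/n≡0 b<q) ⟩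
    h + 0                        ≡⟨ +-identityʳ h ⟩
    h                            ∎))
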